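{- Let $G$ be a finite simple triangle-free graph having a perfect matching $M$. Let $h$ denote the number of connected components of the graph $G\setminus M$ (the spanning subgraph of $G$ with edge set $E(G)\setminus M$). Let $OPT$ denote the number of colours in an optimal (maximum) edge $2$-colouring of $G$. Then $$OPT\leq \frac{8}{5}\bigl(|M|+h\bigr).$$
   Context: An edge $2$-colouring of a graph $G$ is an assignment of colours to the edges of $G$ (not necessarily proper) such that, at every vertex, the edges incident with that vertex carry at most $2$ distinct colours. An optimal edge $2$-colouring is one that uses the maximum possible number of distinct colours; $OPT$ is that maximum number. -}

module Defs where

open import Level using (0ℓ)
open import Data.Nat using (ℕ; _≤_; _≟_)
open import Data.Fin using (Fin; _<_; _<?_)
open import Data.List using (List; length; map; filter; deduplicate; allFin; cartesianProduct)
open import Data.Product using (∃; _×_; _,_; uncurry)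
open import Function using (_⇔_)
open import Function.Definitions using (Surjective)
open import Relation.Nullary using (¬_; ¬?; _×-dec_)
open import Relation.Binary using (Rel; Decidable; Symmetric; Irreflexive)
open import Relation.Binary.PropositionalEquality using (_≡_)
open import Relation.Binary.Construct.Closure.ReflexiveTransitive using (Star)

record Graph (n : ℕ) : Set₁ where
  field
    Adj    : Rel (Fin n) 0ℓ
    adj?   : Decidable Adj
    sym    : Symmetric Adj
    irrefl : Irreflexive _≡_ Adj

  neighbours : Fin n → List (Fin n)
  neighbours v = filter (adj? v) (allFin n)

  -- Each undirected edge is listed once, with its smaller endpoint first.
  edges : List (Fin n × Fin n)
  edges = filter (λ (u , v) → (u <? v) ×-dec adj? u v)
                 (cartesianProduct (allFin n) (allFin n))

open Graph using (Adj; adj?; neighbours; edges)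

TriangleFree : ∀ {n} → Graph n → Set
TriangleFree G = ∀ u v w → Adj G u v → Adj G v w → ¬ Adj G u w

-- A set of edges is represented by the spanning subgraph it forms.
record IsPerfectMatching {n} (G M : Graph n) : Set where
  field
    subgraph : ∀ {u v} → Adj M u v → Adj G u v
    disjoint : ∀ {u v w} → Adj M u v → Adj M u w → v ≡ w
    covering : ∀ u → ∃ λ v → Adj M u v

infixl 6 _∖_

_∖_ : ∀ {n} → Graph n → Graph n → Graph n
G ∖ M = record
  { Adj    = λ u v → Adj G u v × ¬ Adj M u v
  ; adj?   = λ u v → adj? G u v ×-dec ¬? (adj? M u v)
  ; sym    = λ (g , ¬m) → Graph.sym G g , λ m → ¬m (Graph.sym M m)
  ; irrefl = λ u≡v (g , _) → Graph.irrefl G u≡v g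
  }

-- H has exactly h connected components: Fin h is the quotient of the
-- vertex set by the relation "joined by a walk in H".
record HasComponents {n} (H : Graph n) (h : ℕ) : Set where
  field
    component  : Fin n → Fin h
    surjective : Surjective _≡_ _≡_ component
    connected  : ∀ u v → component u ≡ component v ⇔ Star (Adj H) u v

distinct : List ℕ → ℕ
distinct cs = length (deduplicate _≟_ cs)

-- The values of colour on non-adjacent pairs are irrelevant: neither the
-- condition at a vertex nor the number of colours used depends on them.
record Edge2Colouring {n} (G : Graph n) : Set where
  field
    colour     : Fin n → Fin n → ℕ
    colour-sym : ∀ u v → colour u v ≡ colour v u
    atMostTwo  : ∀ v → distinct (map (colour v) (neighbours G v)) ≤ 2

  numColours : ℕ
  numColours = distinct (map (uncurry colour) (edges G))

open Edge2Colouring using (numColours)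

IsOptimal : ∀ {n} {G : Graph n} → Edge2Colouring G → Set
IsOptimal {G = G} c = ∀ (d : Edge2Colouring G) → numColours d ≤ numColours c

IsOPT : ∀ {n} → Graph n → ℕ → Set
IsOPT G k = ∃ λ (c : Edge2Colouring G) → IsOptimal c × numColours c ≡ k

{-# OPTIONS --safe #-}

-- For a colour f let V be the vertices incident with an edge of colour f, s = |V|,
-- let μ be the number of vertices whose M-edge has colour f, and let r be the number
-- of links needed to connect all edges of G ∖ M inside V.  Then 4r + 2μ + 10 ≤ 7s:
-- a spanning star gives r ≤ s - 1, which suffices unless s ≤ 5 and many vertices of V
-- are matched inside V, where parity or triangle-freeness gives the missing saving.
-- Summed over the q colours, Σ s ≤ 2n (two colours per vertex), Σ μ ≥ n (M covers
-- every vertex once) and Σ r ≥ n - h (the links connect G ∖ M), so 10q ≤ 8n + 4h,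
-- where n = 2|M|.

module Submission where

open import Data.Nat using (ℕ; _+_; suc; zero; z≤n; s≤s) renaming (_*_ to _*ℕ_; _≤_ to _≤ℕ_; _<_ to _<ℕ_)
import Data.Nat as ℕ
import Data.Nat.Properties as ℕₚ
open import Data.Nat.ListAction using (sum)
open import Data.Nat.Tactic.RingSolver using (solve-∀)
import Data.Integer as ℤ
import Data.Integer.Properties as ℤₚ
open import Data.Rational using (_/_; _*_; _≤_; toℚᵘ)
import Data.Rational.Properties as ℚₚ
open import Data.Rational.Unnormalised as ℚᵘ using (mkℚᵘ; *≤*)
import Data.Rational.Unnormalised.Properties as ℚᵘₚ
open import Data.Fin using (Fin; _<_; _<?_)
open import Data.Fin.Properties as Finₚ using (injective⇒≤)
open import Data.List using (List; []; _∷_; _++_; length; map; filter; lookup; allFin; deduplicate; cartesianProduct)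
open import Data.List.Properties using (length-map; map-cong; length-++; length-filter; length-tabulate; filter-all; filter-notAll; filter-none; filter-some; filter-reject)
open import Data.List.Membership.Propositional using (_∈_; find)
open import Data.List.Membership.Propositional.Properties
import Data.List.Membership.Setoid.Properties as Setoidₚ
import Data.List.Membership.DecPropositional as DecMembership
open import Data.List.Relation.Unary.All as All using (All; []; _∷_)
import Data.List.Relation.Unary.All.Properties as Allₚ
open import Data.List.Relation.Unary.Any as Any using (here; there)
open import Data.List.Relation.Unary.AllPairs as AllPairs using (AllPairs; []; _∷_)
import Data.List.Relation.Unary.AllPairs.Properties as AllPairsₚ
open import Data.List.Relation.Unary.Unique.Propositional using (Unique)
open import Data.List.Relation.Unary.Unique.Propositional.Properties using (allFin⁺) renaming (filter⁺ to Unique-filter⁺)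
import Data.List.Relation.Unary.Unique.DecPropositional.Properties as DecUnique
open import Data.List.Relation.Binary.Subset.Propositional using (_⊆_)
open import Data.List.Relation.Binary.Permutation.Propositional using (_↭_; ↭-sym; ↭-trans; ↭-prep; ↭⇒↭ₛ)
open import Data.List.Relation.Binary.Permutation.Propositional.Properties using (shift; ∈-resp-↭; ↭-length)
import Data.List.Relation.Binary.Permutation.Setoid.Properties as PermSetoidₚ
open import Data.Product using (∃; _×_; _,_; proj₁; proj₂; uncurry)
open import Function using (_∘_; Equivalence)
open import Level using (Level; 0ℓ)
open import Relation.Binary using (Rel; Reflexive; Symmetric; tri<; tri≈; tri>)
open import Relation.Binary.PropositionalEquality
open import Relation.Binary.Construct.Closure.ReflexiveTransitive using (Star; ε; _◅_)
open import Relation.Nullary using (¬_; ¬?; Dec; yes; no; contradiction)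
open import Relation.Nullary.Decidable using (_×-dec_)
open import Relation.Unary using (Pred; Decidable)
open import Defs

-- Counting in lists: pigeonhole and double counting.

private variable
  a ℓ : Level
  A B : Set a

-- Pigeonhole: sending an index of `xs` to the position in `ys` of its entry is injective.
Unique-⊆⇒length≤ : {xs ys : List A} → Unique xs → xs ⊆ ys → length xs ≤ℕ length ys
Unique-⊆⇒length≤ {A = A} {xs} {ys} xs! xs⊆ys = injective⇒≤ {f = position} position-injective
  where
  position : Fin (length xs) → Fin (length ys)
  position i = Any.index (xs⊆ys (∈-lookup {xs = xs} i))

  lookup-injective : ∀ {zs : List A} → Unique zs → ∀ i j → lookup zs i ≡ lookup zs j → i ≡ j
  lookup-injective (_ ∷ _) Fin.zero Fin.zero _ = refl
  lookup-injective (z∉ ∷ _) Fin.zero (Fin.suc j) eq = contradiction eq (All.lookup z∉ (∈-lookup j))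
  lookup-injective (z∉ ∷ _) (Fin.suc i) Fin.zero eq = contradiction (sym eq) (All.lookup z∉ (∈-lookup i))
  lookup-injective (_ ∷ zs!) (Fin.suc i) (Fin.suc j) eq = cong Fin.suc (lookup-injective zs! i j eq)

  position-injective : ∀ {i j} → position i ≡ position j → i ≡ j
  position-injective {i} {j} eq = lookup-injective xs! i j
    (Setoidₚ.index-injective (setoid A) (xs⊆ys (∈-lookup {xs = xs} i)) (xs⊆ys (∈-lookup {xs = xs} j)) eq)

length-allFin : ∀ n → length (allFin n) ≡ n
length-allFin n = length-tabulate _

Unique-resp-↭ : {xs ys : List A} → xs ↭ ys → Unique xs → Unique ys
Unique-resp-↭ {A = A} σ = PermSetoidₚ.Unique-resp-↭ (setoid A) (↭⇒↭ₛ σ)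

∈⇒↭∷ : {x : A} {xs : List A} → x ∈ xs → ∃ λ ys → xs ↭ x ∷ ys
∈⇒↭∷ x∈xs with ys , zs , refl ← ∈-∃++ x∈xs = ys ++ zs , shift _ ys zs

∈-tail : {x y : A} {xs : List A} → y ≢ x → y ∈ x ∷ xs → y ∈ xs
∈-tail y≢x (here y≡x) = contradiction y≡x y≢x
∈-tail y≢x (there y∈xs) = y∈xs

AllPairs-lookup : {R : Rel A ℓ} {xs : List A} → Reflexive R → Symmetric R → AllPairs R xs →
                  ∀ {x y} → x ∈ xs → y ∈ xs → R x y
AllPairs-lookup r s (_ ∷ _) (here refl) (here refl) = r
AllPairs-lookup r s (Rx ∷ _) (here refl) (there y∈) = All.lookup Rx y∈
AllPairs-lookup r s (Rx ∷ _) (there x∈) (here refl) = s (All.lookup Rx x∈)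
AllPairs-lookup r s (_ ∷ Rxs) (there x∈) (there y∈) = AllPairs-lookup r s Rxs x∈ y∈

module _ {P : A → B → Set} (P? : ∀ x y → Dec (P x y)) where

  degreeˡ : List B → A → ℕ
  degreeˡ ys x = length (filter (P? x) ys)

  degreeʳ : List A → B → ℕ
  degreeʳ xs y = length (filter (λ x → P? x y) xs)

  private
    exchange : ∀ a b c → a + (b + c) ≡ b + (a + c)
    exchange = solve-∀

    step : ∀ x xs ys → sum (map (degreeʳ (x ∷ xs)) ys) ≡ degreeˡ ys x + sum (map (degreeʳ xs) ys)
    step x xs [] = refl
    step x xs (y ∷ ys) with P? x y
    ... | no  _ = trans (cong (degreeʳ xs y +_) (step x xs ys)) (exchange (degreeʳ xs y) (degreeˡ ys x) _)
    ... | yes _ = cong suc (trans (cong (degreeʳ xs y +_) (step x xs ys)) (exchange (degreeʳ xs y) (degreeˡ ys x) _))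

  double-count : ∀ xs ys → sum (map (degreeˡ ys) xs) ≡ sum (map (degreeʳ xs) ys)
  double-count [] [] = refl
  double-count [] (y ∷ ys) = double-count [] ys
  double-count (x ∷ xs) ys = trans (cong (degreeˡ ys x +_) (double-count xs ys)) (sym (step x xs ys))

sum-map-≤ : ∀ c (f : A → ℕ) → (∀ x → f x ≤ℕ c) → ∀ xs → sum (map f xs) ≤ℕ length xs *ℕ c
sum-map-≤ c f f≤c [] = z≤n
sum-map-≤ c f f≤c (x ∷ xs) = ℕₚ.+-mono-≤ (f≤c x) (sum-map-≤ c f f≤c xs)

sum-map-≥ : (f : A → ℕ) → (∀ x → 0 <ℕ f x) → ∀ xs → length xs ≤ℕ sum (map f xs)
sum-map-≥ f 0<f [] = z≤n
sum-map-≥ f 0<f (x ∷ xs) = ℕₚ.+-mono-≤ (0<f x) (sum-map-≥ f 0<f xs)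

filter-filter-⊆ : {P Q : Pred A ℓ} (P? : Decidable P) (Q? : Decidable Q) → (∀ {x} → Q x → P x) →
                  ∀ xs → filter Q? (filter P? xs) ≡ filter Q? xs
filter-filter-⊆ P? Q? Q⇒P [] = refl
filter-filter-⊆ P? Q? Q⇒P (x ∷ xs) with P? x
... | no ¬Px = trans (filter-filter-⊆ P? Q? Q⇒P xs) (sym (filter-reject Q? (¬Px ∘ Q⇒P)))
... | yes _ with Q? x
...   | no  _ = filter-filter-⊆ P? Q? Q⇒P xs
...   | yes _ = cong (x ∷_) (filter-filter-⊆ P? Q? Q⇒P xs)

∈-edges : ∀ {n} (G : Graph n) {u v} → u < v → Graph.Adj G u v → (u , v) ∈ Graph.edges G
∈-edges G {u} {v} u<v uv = ∈-filter⁺ (λ (u , v) → (u <? v) ×-dec Graph.adj? G u v)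
  (∈-cartesianProduct⁺ (∈-allFin u) (∈-allFin v)) (u<v , uv)

-- Links, and how many are needed to connect a graph.

module Links {n : ℕ} where

  Links : Set
  Links = List (Fin n × Fin n)

  Respects : (Fin n → Fin n) → Links → Set
  Respects label L = ∀ {u v} → (u , v) ∈ L → label u ≡ label v

  -- This stands for "joined by a walk of links". Quantifying over the labellings that are constant
  -- along links makes the notion an equivalence, and monotone in `L`, without handling walks.
  Linked : Links → Fin n → Fin n → Set
  Linked L u v = ∀ label → Respects label L → label u ≡ label v

  private
    -- The labels on `R` are pairwise distinct, so at most one entry carries `c`.
    drop-label : ∀ (label : Fin n → Fin n) c {R} → AllPairs (λ u v → label u ≢ label v) R →
                 length R ≤ℕ suc (length (filter (λ v → ¬? (label v Finₚ.≟ c)) R))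
    drop-label label c [] = z≤n
    drop-label label c {x ∷ R} (x∉ ∷ R!) with label x Finₚ.≟ c
    ... | no  _ = s≤s (drop-label label c R!)
    ... | yes refl = s≤s (ℕₚ.≤-reflexive (cong length (sym
            (filter-all (λ v → ¬? (label v Finₚ.≟ label x)) (All.map (λ ≢ eq → ≢ (sym eq)) x∉)))))

  -- Union-find by induction on `L`: a new link merges the label classes of its two ends, which
  -- costs at most one representative.
  representatives : ∀ L → ∃ λ label → ∃ λ R →
                    Respects label L × AllPairs (λ u v → label u ≢ label v) R × n ≤ℕ length L + length R
  representatives [] = (λ v → v) , allFin n , (λ ()) , allFin⁺ n , ℕₚ.≤-reflexive (sym (length-allFin n))
  representatives ((a , b) ∷ L) with label , R , resp , R! , n≤ ← representatives L =
    label′ , R′ , resp′ , R′! , n≤′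
    where
    label′ : Fin n → Fin n
    label′ v with label v Finₚ.≟ label a
    ... | yes _ = label b
    ... | no  _ = label v

    label′-cong : ∀ {u v} → label u ≡ label v → label′ u ≡ label′ v
    label′-cong {u} {v} eq with label u Finₚ.≟ label a | label v Finₚ.≟ label a
    ... | yes _ | yes _ = refl
    ... | yes p | no ¬q = contradiction (trans (sym eq) p) ¬q
    ... | no ¬p | yes q = contradiction (trans eq q) ¬p
    ... | no  _ | no  _ = eq

    label′-a : label′ a ≡ label b
    label′-a with label a Finₚ.≟ label a
    ... | yes _ = refl
    ... | no ¬p = contradiction refl ¬p

    label′-b : label′ b ≡ label b
    label′-b with label b Finₚ.≟ label a
    ... | yes _ = refl
    ... | no  _ = refl

    label′-other : ∀ {v} → label v ≢ label a → label′ v ≡ label v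
    label′-other {v} ≢a with label v Finₚ.≟ label a
    ... | yes p = contradiction p ≢a
    ... | no  _ = refl

    resp′ : Respects label′ ((a , b) ∷ L)
    resp′ (here refl) = trans label′-a (sym label′-b)
    resp′ (there uv∈L) = label′-cong (resp uv∈L)

    -- A representative labelled like `a` now gets the label of `b`, which another one may carry
    -- already. It is discarded; all the others keep their labels.
    other? : Decidable (λ v → label v ≢ label a)
    other? v = ¬? (label v Finₚ.≟ label a)

    R′ : List (Fin n)
    R′ = filter other? R

    transfer : ∀ {S} → All (λ v → label v ≢ label a) S → AllPairs (λ u v → label u ≢ label v) S →
               AllPairs (λ u v → label′ u ≢ label′ v) S
    transfer [] [] = []
    transfer (x≢ ∷ S≢) (x∉ ∷ S!) =
      All.zipWith (λ (y≢ , ≢) eq → ≢ (trans (sym (label′-other x≢)) (trans eq (label′-other y≢)))) (S≢ , x∉)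
      ∷ transfer S≢ S!

    R′! : AllPairs (λ u v → label′ u ≢ label′ v) R′
    R′! = transfer (Allₚ.all-filter other? R) (AllPairsₚ.filter⁺ other? R!)

    n≤′ : n ≤ℕ suc (length L) + length R′
    n≤′ = begin
      n                           ≤⟨ n≤ ⟩
      length L + length R         ≤⟨ ℕₚ.+-monoʳ-≤ (length L) (drop-label label (label a) R!) ⟩
      length L + suc (length R′)  ≡⟨ ℕₚ.+-suc (length L) (length R′) ⟩
      suc (length L) + length R′  ∎
      where open ℕₚ.≤-Reasoning

  -- Every edge of `H` preserves a labelling that respects `L`, so the labelling is constant on
  -- components. Representatives with distinct labels thus lie in distinct components, and there are
  -- at most `h` of them.
  n≤links+components : ∀ {H : Graph n} {h} → HasComponents H h → ∀ L →
                       (∀ {u v} → Graph.Adj H u v → Linked L u v) → n ≤ℕ length L + h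
  n≤links+components {H} {h} hc L linked with label , R , resp , R! , n≤ ← representatives L = begin
    n                                   ≤⟨ n≤ ⟩
    length L + length R                 ≡⟨ cong (length L +_) (length-map component R) ⟨
    length L + length (map component R) ≤⟨ ℕₚ.+-monoʳ-≤ (length L) (Unique-⊆⇒length≤
                                             (AllPairsₚ.map⁺ (AllPairs.map (λ ≢ eq → ≢ (constant (Equivalence.to (connected _ _) eq))) R!))
                                             (λ {i} _ → ∈-allFin i)) ⟩
    length L + length (allFin h)        ≡⟨ cong (length L +_) (length-allFin h) ⟩
    length L + h                        ∎
    where
    open ℕₚ.≤-Reasoning
    open HasComponents hc

    constant : ∀ {u v} → Star (Graph.Adj H) u v → label u ≡ label v
    constant ε = refl
    constant (uv ◅ vw) = trans (linked uv label resp) (constant vw)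

-- Vertex sets under the matching involution.

module ColourClass {n : ℕ} (G M : Graph n) (triangle-free : TriangleFree G) (pm : IsPerfectMatching G M) where

  open Links {n}
  open Graph using (Adj; adj?)
  open IsPerfectMatching pm

  partner : Fin n → Fin n
  partner v = proj₁ (covering v)

  M-partner : ∀ v → Adj M v (partner v)
  M-partner v = proj₂ (covering v)

  G-sym : ∀ {u v} → Adj G u v → Adj G v u
  G-sym = Graph.sym G

  partner-unique : ∀ {u v} → Adj M u v → partner u ≡ v
  partner-unique {u} uv = disjoint (M-partner u) uv

  partner-involutive : ∀ v → partner (partner v) ≡ v
  partner-involutive v = partner-unique (Graph.sym M (M-partner v))

  partner≢ : ∀ v → partner v ≢ v
  partner≢ v eq = Graph.irrefl M (sym eq) (M-partner v)

  Closed : List (Fin n) → Set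
  Closed V = ∀ {v} → v ∈ V → partner v ∈ V

  LinkedIfAdj : Links → Fin n → Fin n → Set
  LinkedIfAdj L u v = Adj (G ∖ M) u v → Linked L u v

  -- All edges of `G ∖ M` inside `V` count here, whatever their colour. Pairs that are nonadjacent
  -- or matched demand nothing, and this is where links are saved.
  Covers : Links → List (Fin n) → Set
  Covers L V = ∀ {u v} → u ∈ V → v ∈ V → LinkedIfAdj L u v

  -- Linking is reflexive and symmetric, so each unordered pair of an explicit listing is checked
  -- once.
  covers : ∀ {L V W} → V ↭ W → AllPairs (LinkedIfAdj L) W → Covers L V
  covers {L} σ pairs u∈ v∈ =
    AllPairs-lookup (λ _ _ _ → refl)
      (λ {x} {y} Rxy yx label resp → sym (Rxy (Graph.sym (G ∖ M) {y} {x} yx) label resp))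
      pairs (∈-resp-↭ σ u∈) (∈-resp-↭ σ v∈)

  link : ∀ {L u v} → (u , v) ∈ L → LinkedIfAdj L u v
  link uv∈L _ _ resp = resp uv∈L

  matched : ∀ {L u v} → Adj M u v → LinkedIfAdj L u v
  matched m (_ , ¬m) = contradiction m ¬m

  nonadjacent : ∀ {L u v} → ¬ Adj G u v → LinkedIfAdj L u v
  nonadjacent ¬g (g , _) = contradiction g ¬g

  extract-pair : ∀ {x V} → x ∈ V → partner x ∈ V → ∃ λ W → V ↭ x ∷ partner x ∷ W
  extract-pair {x} x∈V px∈V with V′ , σ ← ∈⇒↭∷ x∈V
    with W , τ ← ∈⇒↭∷ (∈-tail (partner≢ x) (∈-resp-↭ σ px∈V)) = W , ↭-trans σ (↭-prep x τ)

  -- As `partner` is an involution, a vertex whose partner is `x` or `partner x` is itself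
  -- `partner x` or `x`, hence not in `W`.
  closed-remainder : ∀ {x V W} → Unique V → Closed V → V ↭ x ∷ partner x ∷ W → Closed W
  closed-remainder {x} V! V-closed σ {v} v∈W with Unique-resp-↭ σ V!
  ... | (_ ∷ x∉W) ∷ (px∉W ∷ _) =
    ∈-tail (λ eq → All.lookup x∉W v∈W (trans (sym (partner-involutive x)) (trans (cong partner (sym eq)) (partner-involutive v))))
      (∈-tail (λ eq → All.lookup px∉W v∈W (trans (cong partner (sym eq)) (partner-involutive v)))
        (∈-resp-↭ σ (V-closed (∈-resp-↭ (↭-sym σ) (there (there v∈W))))))

  -- Matched pairs are removed one at a time; a single vertex would remain, without room for its
  -- partner.
  closed⇒¬odd : ∀ k {V} → Unique V → Closed V → length V ≢ suc (k *ℕ 2)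
  closed⇒¬odd k {x ∷ _} V! V-closed |V| with extract-pair (here refl) (V-closed (here refl))
  closed⇒¬odd zero V! V-closed |V| | W , σ = contradiction (trans (sym (↭-length σ)) |V|) (λ ())
  closed⇒¬odd (suc k) V! V-closed |V| | W , σ =
    closed⇒¬odd k (AllPairs.tail (AllPairs.tail (Unique-resp-↭ σ V!))) (closed-remainder V! V-closed σ)
      (ℕₚ.suc-injective (ℕₚ.suc-injective (trans (sym (↭-length σ)) |V|)))

  -- Economical link sets for small vertex sets.

  star : Fin n → List (Fin n) → Links
  star x = map (x ,_)

  star-covers : ∀ x V → Covers (star x V) (x ∷ V)
  star-covers x V u∈ v∈ _ label resp = trans (sym (centre u∈)) (centre v∈)
    where
    centre : ∀ {u} → u ∈ x ∷ V → label x ≡ label u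
    centre (here refl) = refl
    centre (there u∈V) = resp (∈-map⁺ (x ,_) u∈V)

  -- By triangle-freeness `z` is adjacent to at most one end of the edge `x y`, so one link replaces
  -- the two of a star.
  three : ∀ {V x y z} → V ↭ x ∷ y ∷ z ∷ [] → Adj M x y → ∃ λ L → length L ≡ 1 × Covers L V
  three {x = x} {y} {z} σ xy with adj? G x z
  ... | yes xz = (x , z) ∷ [] , refl , covers σ
        ((matched xy ∷ link (here refl) ∷ []) ∷
         (nonadjacent (λ yz → triangle-free x y z (subgraph xy) yz xz) ∷ []) ∷ [] ∷ [])
  ... | no ¬xz = (y , z) ∷ [] , refl , covers σ
        ((matched xy ∷ nonadjacent ¬xz ∷ []) ∷ (link (here refl) ∷ []) ∷ [] ∷ [])

  -- Two cross edges sharing an end would form a triangle with `x y` or `z w`. The cross edges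
  -- therefore lie within `x z`, `y w` or within `x w`, `y z`, and two links replace the three of a
  -- star.
  four : ∀ {V x y z w} → V ↭ x ∷ y ∷ z ∷ w ∷ [] → Adj M x y → Adj M z w → ∃ λ L → length L ≡ 2 × Covers L V
  four {x = x} {y} {z} {w} σ xy zw with adj? G x z | adj? G y w
  ... | yes xz | _ = (x , z) ∷ (y , w) ∷ [] , refl , covers σ
        ((matched xy ∷ link (here refl) ∷ nonadjacent (λ xw → triangle-free x z w xz (subgraph zw) xw) ∷ []) ∷
         (nonadjacent (λ yz → triangle-free x y z (subgraph xy) yz xz) ∷ link (there (here refl)) ∷ []) ∷
         (matched zw ∷ []) ∷ [] ∷ [])
  ... | no _ | yes yw = (x , z) ∷ (y , w) ∷ [] , refl , covers σ
        ((matched xy ∷ link (here refl) ∷ nonadjacent (λ xw → triangle-free x y w (subgraph xy) yw xw) ∷ []) ∷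
         (nonadjacent (λ yz → triangle-free y z w yz (subgraph zw) yw) ∷ link (there (here refl)) ∷ []) ∷
         (matched zw ∷ []) ∷ [] ∷ [])
  ... | no ¬xz | no ¬yw = (x , w) ∷ (y , z) ∷ [] , refl , covers σ
        ((matched xy ∷ nonadjacent ¬xz ∷ link (here refl) ∷ []) ∷
         (link (there (here refl)) ∷ nonadjacent ¬yw ∷ []) ∷
         (matched zw ∷ []) ∷ [] ∷ [])

  -- The inequality for a single colour class.

  module _ {P : Pred (Fin n) 0ℓ} (P? : Decidable P) where

    Bounded : List (Fin n) → Set
    Bounded V = ∃ λ L → 4 *ℕ length L + 2 *ℕ length (filter P? V) + 10 ≤ℕ 7 *ℕ length V × Covers L V

    private
      bounded : ∀ {V r c} L → length L ≡ r → length (filter P? V) ≤ℕ c →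
                4 *ℕ r + 2 *ℕ c + 10 ≤ℕ 7 *ℕ length V → Covers L V → Bounded V
      bounded L refl μ≤c le cov =
        L , ℕₚ.≤-trans (ℕₚ.+-monoˡ-≤ 10 (ℕₚ.+-monoʳ-≤ (4 *ℕ length L) (ℕₚ.*-monoʳ-≤ 2 μ≤c))) le , cov

      starry : ∀ {x V c} → length (filter P? (x ∷ V)) ≤ℕ c →
               4 *ℕ length V + 2 *ℕ c + 10 ≤ℕ 7 *ℕ suc (length V) → Bounded (x ∷ V)
      starry {x} {V} μ≤c le = bounded (star x V) (length-map (x ,_) V) μ≤c le (star-covers x V)

      none : ∀ V → ¬ Any.Any P V → length (filter P? V) ≤ℕ 0
      none V ¬any = ℕₚ.≤-reflexive (cong length (filter-none P? (Allₚ.¬Any⇒All¬ V ¬any)))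

      notAll : ∀ V → ¬ All P V → length (filter P? V) <ℕ length V
      notAll V ¬all = filter-notAll P? V (Allₚ.¬All⇒Any¬ P? V ¬all)

      -- With `s = 6 + k` vertices a star has `s - 1` links and at most `s` vertices satisfy `P`;
      -- the slack is exactly `k`, so six is the least size at which this crude estimate works.
      starry-arith : ∀ k → 4 *ℕ (5 + k) + 2 *ℕ (6 + k) + 10 ≤ℕ 7 *ℕ (6 + k)
      starry-arith k = ℕₚ.≤-trans (ℕₚ.m≤m+n _ k) (ℕₚ.≤-reflexive (identity k))
        where
        identity : ∀ k → 4 *ℕ (5 + k) + 2 *ℕ (6 + k) + 10 + k ≡ 7 *ℕ (6 + k)
        identity = solve-∀

    -- Write `s` for the size and `μ` for the number of vertices satisfying `P`. A star suffices
    -- when `μ = 0` for `s` equal to 2 or 3, when `μ < s` for `s` equal to 4 or 5, and always from 6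
    -- on. The remaining cases contain matched pairs: they need `s - 2` links for `s` at most 4, and
    -- parity excludes `s = μ = 5`.
    class-bound : ∀ V → Unique V → (∀ {v} → v ∈ V → P v → partner v ∈ V) → 2 ≤ℕ length V → Bounded V
    class-bound (_ ∷ []) _ _ (s≤s ())
    class-bound V@(_ ∷ _ ∷ []) _ closed _ with Any.any? P? V
    ... | no ¬any = starry (none V ¬any) (ℕₚ.≤ᵇ⇒≤ _ _ _)
    ... | yes any with v , v∈V , Pv ← find any with extract-pair v∈V (closed v∈V Pv)
    ...   | [] , σ = bounded [] refl (length-filter P? V) (ℕₚ.≤ᵇ⇒≤ _ _ _)
                       (covers σ ((matched (M-partner v) ∷ []) ∷ [] ∷ []))
    ...   | _ ∷ _ , σ with () ← ↭-length σ
    class-bound V@(_ ∷ _ ∷ _ ∷ []) _ closed _ with Any.any? P? V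
    ... | no ¬any = starry (none V ¬any) (ℕₚ.≤ᵇ⇒≤ _ _ _)
    ... | yes any with v , v∈V , Pv ← find any with extract-pair v∈V (closed v∈V Pv)
    ...   | [] , σ with () ← ↭-length σ
    ...   | _ ∷ _ ∷ _ , σ with () ← ↭-length σ
    ...   | _ ∷ [] , σ with L , |L| , cov ← three σ (M-partner v) =
              bounded L |L| (length-filter P? V) (ℕₚ.≤ᵇ⇒≤ _ _ _) cov
    class-bound V@(x ∷ _ ∷ _ ∷ _ ∷ []) V! closed _ with All.all? P? V
    ... | no ¬all = starry (ℕₚ.≤-pred (notAll V ¬all)) (ℕₚ.≤ᵇ⇒≤ _ _ _)
    ... | yes all with extract-pair (here refl) (closed (here refl) (All.lookup all (here refl)))
    ...   | [] , σ with () ← ↭-length σ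
    ...   | _ ∷ [] , σ with () ← ↭-length σ
    ...   | _ ∷ _ ∷ _ ∷ _ , σ with () ← ↭-length σ
    ...   | z ∷ w ∷ [] , σ
      -- Since all four vertices satisfy `P`, the set is closed under `partner`, so the two left
      -- over are matched to each other.
      with closed-remainder V! (λ v∈V → closed v∈V (All.lookup all v∈V)) σ (here refl)
    ...     | here eq = contradiction eq (partner≢ z)
    ...     | there (here eq) with L , |L| , cov ← four σ (M-partner x) (subst (Adj M z) eq (M-partner z)) =
                bounded L |L| (length-filter P? V) (ℕₚ.≤ᵇ⇒≤ _ _ _) cov
    class-bound V@(_ ∷ _ ∷ _ ∷ _ ∷ _ ∷ []) V! closed _ with All.all? P? V
    ... | no ¬all = starry (ℕₚ.≤-pred (notAll V ¬all)) (ℕₚ.≤ᵇ⇒≤ _ _ _)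
    ... | yes all = contradiction refl (closed⇒¬odd 2 V! (λ v∈V → closed v∈V (All.lookup all v∈V)))
    class-bound V@(_ ∷ _ ∷ _ ∷ _ ∷ _ ∷ _ ∷ W) _ _ _ =
      starry (length-filter P? V) (starry-arith (length W))


  -- Colour classes of a colouring, and their links put together.

  module _ (c : Edge2Colouring G) where

    open Edge2Colouring c
    open DecMembership ℕₚ._≟_ using (_∈?_)

    palette : Fin n → List ℕ
    palette v = deduplicate ℕ._≟_ (map (colour v) (Graph.neighbours G v))

    colours : List ℕ
    colours = deduplicate ℕ._≟_ (map (uncurry colour) (Graph.edges G))

    M-colour : Fin n → ℕ
    M-colour v = colour v (partner v)

    class : ℕ → List (Fin n)
    class f = filter (λ v → f ∈? palette v) (allFin n)

    M-coloured? : ∀ f v → Dec (f ≡ M-colour v)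
    M-coloured? f v = f ℕ.≟ M-colour v

    colour∈palette : ∀ {u v} → Adj G u v → colour u v ∈ palette u
    colour∈palette {u} {v} uv =
      ∈-deduplicate⁺ ℕ._≟_ (∈-map⁺ (colour u) (∈-filter⁺ (adj? G u) (∈-allFin v) uv))

    colour∈palette′ : ∀ {u v} → Adj G u v → colour u v ∈ palette v
    colour∈palette′ {u} {v} uv = subst (_∈ palette v) (colour-sym v u) (colour∈palette (G-sym uv))

    ∈class : ∀ {f v} → f ∈ palette v → v ∈ class f
    ∈class {f} {v} = ∈-filter⁺ (λ v → f ∈? palette v) (∈-allFin v)

    colour∈colours : ∀ {u v} → Adj G u v → colour u v ∈ colours
    colour∈colours {u} {v} uv with Finₚ.<-cmp u v
    ... | tri< u<v _ _ = ∈-deduplicate⁺ ℕ._≟_ (∈-map⁺ (uncurry colour) (∈-edges G u<v uv))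
    ... | tri≈ _ u≡v _ = contradiction uv (Graph.irrefl G u≡v)
    ... | tri> _ _ v<u = subst (_∈ colours) (colour-sym v u)
                           (∈-deduplicate⁺ ℕ._≟_ (∈-map⁺ (uncurry colour) (∈-edges G v<u (G-sym uv))))

    two≤class : ∀ {f} → f ∈ colours → 2 ≤ℕ length (class f)
    two≤class {f} f∈ with (u , v) , uv∈E , refl ← ∈-map⁻ (uncurry colour) (∈-deduplicate⁻ ℕ._≟_ _ f∈)
      with _ , u<v , uv ← ∈-filter⁻ (λ (u , v) → (u <? v) ×-dec adj? G u v) {xs = cartesianProduct (allFin n) (allFin n)} uv∈E =
      Unique-⊆⇒length≤ {xs = u ∷ v ∷ []} (((λ eq → Graph.irrefl G eq uv) ∷ []) ∷ [] ∷ [])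
        λ where (here refl) → ∈class (colour∈palette uv)
                (there (here refl)) → ∈class (colour∈palette′ uv)

    class-links : ∀ {f} → f ∈ colours → Bounded (M-coloured? f) (class f)
    class-links {f} f∈ = class-bound (M-coloured? f) (class f)
      (Unique-filter⁺ (λ v → f ∈? palette v) (allFin⁺ n))
      -- If the `M`-edge at `v` has colour `f`, its other end meets `f` too.
      (λ { {v} _ refl → ∈class (colour∈palette′ (subgraph (M-partner v))) })
      (two≤class f∈)

    μ : ℕ → ℕ
    μ f = length (filter (M-coloured? f) (class f))

    size : ℕ → ℕ
    size f = length (class f)

    -- Induction over the colours, concatenating the link lists. Coverage survives because a
    -- labelling that respects the longer list respects each part.
    all-links : ∀ Q → Q ⊆ colours → ∃ λ L →
                4 *ℕ length L + 2 *ℕ sum (map μ Q) + length Q *ℕ 10 ≤ℕ 7 *ℕ sum (map size Q) ×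
                All (λ f → Covers L (class f)) Q
    all-links [] _ = [] , z≤n , []
    all-links (f ∷ Q) Q⊆
      with L₁ , le₁ , cov₁ ← class-links (Q⊆ (here refl))
         | L₂ , le₂ , cov₂ ← all-links Q (Q⊆ ∘ there) =
      L₁ ++ L₂ , le , cover-left ∷ All.map cover-right cov₂
      where
      open ℕₚ.≤-Reasoning

      cover-left : Covers (L₁ ++ L₂) (class f)
      cover-left u∈ v∈ uv label resp = cov₁ u∈ v∈ uv label (resp ∘ ∈-++⁺ˡ)

      cover-right : ∀ {g} → Covers L₂ (class g) → Covers (L₁ ++ L₂) (class g)
      cover-right cov u∈ v∈ uv label resp = cov u∈ v∈ uv label (resp ∘ ∈-++⁺ʳ L₁)

      regroup : ∀ l₁ l₂ m₁ m₂ q → 4 *ℕ (l₁ + l₂) + 2 *ℕ (m₁ + m₂) + (10 + q *ℕ 10) ≡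
                                  (4 *ℕ l₁ + 2 *ℕ m₁ + 10) + (4 *ℕ l₂ + 2 *ℕ m₂ + q *ℕ 10)
      regroup = solve-∀

      le = begin
        4 *ℕ length (L₁ ++ L₂) + 2 *ℕ (μ f + sum (map μ Q)) + (10 + length Q *ℕ 10)
          ≡⟨ cong (λ l → 4 *ℕ l + 2 *ℕ (μ f + sum (map μ Q)) + (10 + length Q *ℕ 10)) (length-++ L₁) ⟩
        4 *ℕ (length L₁ + length L₂) + 2 *ℕ (μ f + sum (map μ Q)) + (10 + length Q *ℕ 10)
          ≡⟨ regroup (length L₁) (length L₂) (μ f) (sum (map μ Q)) (length Q) ⟩
        (4 *ℕ length L₁ + 2 *ℕ μ f + 10) + (4 *ℕ length L₂ + 2 *ℕ sum (map μ Q) + length Q *ℕ 10)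
          ≤⟨ ℕₚ.+-mono-≤ le₁ le₂ ⟩
        7 *ℕ size f + 7 *ℕ sum (map size Q)
          ≡⟨ ℕₚ.*-distribˡ-+ 7 (size f) (sum (map size Q)) ⟨
        7 *ℕ (size f + sum (map size Q)) ∎

    -- Summation over all colours.

    colours! : Unique colours
    colours! = DecUnique.deduplicate-! ℕ._≟_ _

    -- Counted from the vertices: `v` lies in one class for each colour of its palette, hence in at
    -- most two.
    Σ-size : sum (map size colours) ≤ℕ n *ℕ 2
    Σ-size = begin
      sum (map size colours)
        ≡⟨ double-count (λ f v → f ∈? palette v) colours (allFin n) ⟩
      sum (map (degreeʳ (λ f v → f ∈? palette v) colours) (allFin n))
        ≤⟨ sum-map-≤ 2 _ (λ v → ℕₚ.≤-trans
             (Unique-⊆⇒length≤ (Unique-filter⁺ (_∈? palette v) colours!)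
               (λ f∈ → proj₂ (∈-filter⁻ (_∈? palette v) {xs = colours} f∈)))
             (atMostTwo v)) (allFin n) ⟩
      length (allFin n) *ℕ 2
        ≡⟨ cong (_*ℕ 2) (length-allFin n) ⟩
      n *ℕ 2 ∎
      where open ℕₚ.≤-Reasoning

    -- Counted from the vertices: the colour of the `M`-edge at `v` occurs in `colours`, so each `v`
    -- contributes at least once.
    Σ-μ : n ≤ℕ sum (map μ colours)
    Σ-μ = begin
      n                                                       ≡⟨ length-allFin n ⟨
      length (allFin n)                                       ≤⟨ sum-map-≥ _ (λ v → filter-some (λ f → M-coloured? f v)
                                                                   (Any.map sym (colour∈colours (subgraph (M-partner v))))) (allFin n) ⟩
      sum (map (degreeʳ M-coloured? colours) (allFin n))      ≡⟨ double-count M-coloured? colours (allFin n) ⟨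
      sum (map (degreeˡ M-coloured? (allFin n)) colours)      ≡⟨ cong sum (map-cong restrict colours) ⟨
      sum (map μ colours)                                     ∎
      where
      open ℕₚ.≤-Reasoning

      -- Restricting to `class f` loses nothing, as a vertex whose `M`-edge has colour `f` lies in
      -- that class.
      restrict : ∀ f → μ f ≡ degreeˡ M-coloured? (allFin n) f
      restrict f = cong length (filter-filter-⊆ (λ v → f ∈? palette v) (M-coloured? f)
        (λ { {v} refl → colour∈palette (subgraph (M-partner v)) }) (allFin n))

    numColours-bound : ∀ {h} → HasComponents (G ∖ M) h → 10 *ℕ numColours ≤ℕ 8 *ℕ n + 4 *ℕ h
    numColours-bound {h} hc with L , le , cov ← all-links colours (λ f∈ → f∈) =
      -- The added `6 n` splits as `4 n`, paid by links and components, and `2 n`, paid by `Σ-μ`; on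
      -- the right it is taken out of `7 * 2 n`.
      ℕₚ.+-cancelˡ-≤ (6 *ℕ n) _ _ (begin
        6 *ℕ n + 10 *ℕ q
          ≡⟨ split n q ⟩
        4 *ℕ n + 2 *ℕ n + q *ℕ 10
          ≤⟨ ℕₚ.+-monoˡ-≤ (q *ℕ 10) (ℕₚ.+-mono-≤ (ℕₚ.*-monoʳ-≤ 4 (n≤links+components hc L linked)) (ℕₚ.*-monoʳ-≤ 2 Σ-μ)) ⟩
        4 *ℕ (length L + h) + 2 *ℕ sum (map μ colours) + q *ℕ 10
          ≡⟨ regroup (length L) h (sum (map μ colours)) q ⟩
        (4 *ℕ length L + 2 *ℕ sum (map μ colours) + q *ℕ 10) + 4 *ℕ h
          ≤⟨ ℕₚ.+-monoˡ-≤ (4 *ℕ h) (ℕₚ.≤-trans le (ℕₚ.*-monoʳ-≤ 7 Σ-size)) ⟩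
        7 *ℕ (n *ℕ 2) + 4 *ℕ h
          ≡⟨ collect n h ⟩
        6 *ℕ n + (8 *ℕ n + 4 *ℕ h) ∎)
      where
      open ℕₚ.≤-Reasoning
      q = numColours

      -- Both ends of an edge lie in the class of its colour, whose links cover it.
      linked : ∀ {u v} → Adj (G ∖ M) u v → Linked L u v
      linked uv@(g , _) =
        All.lookup cov (colour∈colours g) (∈class (colour∈palette g)) (∈class (colour∈palette′ g)) uv

      split : ∀ n q → 6 *ℕ n + 10 *ℕ q ≡ 4 *ℕ n + 2 *ℕ n + q *ℕ 10
      split = solve-∀

      regroup : ∀ l h m q → 4 *ℕ (l + h) + 2 *ℕ m + q *ℕ 10 ≡ (4 *ℕ l + 2 *ℕ m + q *ℕ 10) + 4 *ℕ h
      regroup = solve-∀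

      collect : ∀ n h → 7 *ℕ (n *ℕ 2) + 4 *ℕ h ≡ 6 *ℕ n + (8 *ℕ n + 4 *ℕ h)
      collect = solve-∀

  -- The number of vertices in terms of the matching.

  n≤2|M| : n ≤ℕ length (Graph.edges M) + length (Graph.edges M)
  n≤2|M| = begin
    n                                     ≡⟨ length-allFin n ⟨
    length (allFin n)                     ≤⟨ Unique-⊆⇒length≤ (allFin⁺ n) (λ {v} _ → endpoint v) ⟩
    length (map proj₁ E ++ map proj₂ E)   ≡⟨ length-++ (map proj₁ E) ⟩
    length (map proj₁ E) + length (map proj₂ E) ≡⟨ cong₂ _+_ (length-map proj₁ E) (length-map proj₂ E) ⟩
    length E + length E                   ∎
    where
    open ℕₚ.≤-Reasoning
    E = Graph.edges M

    endpoint : ∀ v → v ∈ map proj₁ E ++ map proj₂ E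
    -- Edges are listed with the smaller end first, so `v` is a first or a second component
    -- according to its order relative to its partner.
    endpoint v with Finₚ.<-cmp v (partner v)
    ... | tri< v<p _ _ = ∈-++⁺ˡ (∈-map⁺ proj₁ (∈-edges M v<p (M-partner v)))
    ... | tri≈ _ v≡p _ = contradiction (sym v≡p) (partner≢ v)
    ... | tri> _ _ p<v = ∈-++⁺ʳ (map proj₁ E) (∈-map⁺ proj₂ (∈-edges M p<v (Graph.sym M (M-partner v))))

-- Passage to rational numbers and conclusion.

open import Data.Integer using (+_)

5q≤8m⇒q≤8/5m : ∀ q m → 5 *ℕ q ≤ℕ 8 *ℕ m → (+ q) / 1 ≤ ((+ 8) / 5) * ((+ m) / 1)
5q≤8m⇒q≤8/5m q m le = ℚₚ.toℚᵘ-cancel-≤ (begin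
  -- Unnormalised fractions compare by cross-multiplication. `mkℚᵘ` stores the denominator minus
  -- one, so `mkℚᵘ (+ 8) 4` is 8/5.
  toℚᵘ ((+ q) / 1)                          ≃⟨ ℚₚ.toℚᵘ-fromℚᵘ (mkℚᵘ (+ q) 0) ⟩
  mkℚᵘ (+ q) 0                              ≤⟨ *≤* cross ⟩
  mkℚᵘ (+ 8) 4 ℚᵘ.* mkℚᵘ (+ m) 0            ≃⟨ ℚᵘₚ.*-congˡ {mkℚᵘ (+ 8) 4} (ℚₚ.toℚᵘ-fromℚᵘ (mkℚᵘ (+ m) 0)) ⟨
  toℚᵘ ((+ 8) / 5) ℚᵘ.* toℚᵘ ((+ m) / 1)    ≃⟨ ℚₚ.toℚᵘ-homo-* ((+ 8) / 5) ((+ m) / 1) ⟨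
  toℚᵘ (((+ 8) / 5) * ((+ m) / 1))          ∎)
  where
  open ℚᵘₚ.≤-Reasoning
  cross : (+ q) ℤ.* (+ 5) ℤ.≤ ((+ 8) ℤ.* (+ m)) ℤ.* (+ 1)
  cross = subst₂ ℤ._≤_ (trans (cong +_ (ℕₚ.*-comm 5 q)) (ℤₚ.pos-* q 5))
    (trans (ℤₚ.pos-* 8 m) (sym (ℤₚ.*-identityʳ _))) (ℤ.+≤+ le)

theorem1 : ∀ (n : ℕ) (G M : Graph n) →
    TriangleFree G →
    IsPerfectMatching G M →
    ∀ (h : ℕ) → HasComponents (G ∖ M) h →
    ∀ (OPT : ℕ) → IsOPT G OPT →
    (+ OPT) / 1 ≤ ((+ 8) / 5) * ((+ (length (Graph.edges M) + h)) / 1)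
theorem1 n G M triangle-free pm h hc OPT (c , _ , refl) =
  5q≤8m⇒q≤8/5m OPT (m + h) (ℕₚ.*-cancelˡ-≤ 2 (begin
    2 *ℕ (5 *ℕ OPT)              ≡⟨ ℕₚ.*-assoc 2 5 OPT ⟨
    10 *ℕ OPT                    ≤⟨ numColours-bound c hc ⟩
    -- Raising the coefficient of `h` from 4 to 16 matches that of `m`, giving the common factor
    -- `m + h`.
    8 *ℕ n + 4 *ℕ h              ≤⟨ ℕₚ.+-mono-≤ (ℕₚ.*-monoʳ-≤ 8 n≤2|M|) (ℕₚ.m≤m+n (4 *ℕ h) (12 *ℕ h)) ⟩
    8 *ℕ (m + m) + (4 *ℕ h + 12 *ℕ h)  ≡⟨ regroup m h ⟩
    2 *ℕ (8 *ℕ (m + h))          ∎))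
  where
  open ℕₚ.≤-Reasoning
  open ColourClass G M triangle-free pm
  m = length (Graph.edges M)

  regroup : ∀ m h → 8 *ℕ (m + m) + (4 *ℕ h + 12 *ℕ h) ≡ 2 *ℕ (8 *ℕ (m + h))
  regroup = solve-∀
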